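{- Let $G$ and $H$ be graphs such that: (a) $G$ admits an automorphism $\eta$ with $\eta(v)\in N(v)$ for every $v\in V(G)$, and every orbit of $\eta$ has even length; (b) $H$ is bipartite and every vertex of $H$ has even degree. Then $\alpha_{\mathrm{od}}(\mu[G,H])\ge |H|\cdot\alpha_{\mathrm{od}}(G)$.
   Context: For graphs $G$ and $H$, $\mu[G,H]$ is the graph obtained by replacing each vertex $w\in V(H)$ with a copy $G_w$ of $G$ and, for every edge $w_1w_2\in E(H)$, adding the perfect matching between $G_{w_1}$ and $G_{w_2}$ that joins the two copies of each vertex of $G$ (i.e., $\mu[G,H]$ is the Cartesian product $G\,\Box\,H$). An odd independent set in a graph $F=(V,E)$ is an independent set $S$ such that every $v\in V\setminus S$ has either no neighbor or an odd number of neighbors in $S$; $\alpha_{\mathrm{od}}(F)$ is the maximum size of such a set. $|H|$ is the number of vertices of $H$; $N(v)$ is the open neighborhood. -}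

module Defs where

open import Level using (0ℓ)
open import Data.Nat using (ℕ; zero; suc; _*_; _≤_)
import Data.Nat as ℕ
open import Data.Nat.Divisibility using (_∣_; _∤_; _∣?_)
open import Data.Fin using (Fin; quotient; remainder; _≟_)
open import Data.Fin.Properties using (all?)
open import Data.Fin.Permutation using (Permutation′; _⟨$⟩ʳ_)
open import Data.Fin.Subset using (Subset; inside; outside; _∈_; _∉_; _∩_; ∁; ⊥; ∣_∣)
open import Data.Fin.Subset.Properties using (_∈?_; ∉⊥; ∣⊥∣≡0; ∩-zeroʳ)
open import Data.List using (List; []; _∷_; _++_; map; filter)
open import Data.List.Extrema.Nat using (max; xs≤max; argmax-sel)
import Data.List.Membership.Propositional as List
open import Data.List.Membership.Propositional.Properties using (∈-map⁺; ∈-map⁻; ∈-++⁺ˡ; ∈-++⁺ʳ; ∈-filter⁺; ∈-filter⁻)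
open import Data.List.Relation.Unary.Any using (here)
import Data.List.Relation.Unary.All as All
open import Data.Product using (_×_; _,_; ∃-syntax; proj₂)
open import Data.Sum using (_⊎_; inj₁; inj₂)
import Data.Sum as Sum
import Data.Product as Product
open import Data.Vec using ([]; _∷_; tabulate)
open import Function using (id; _⇔_)
import Function.Endo.Propositional as Endo
open import Relation.Binary using (Rel; Decidable; Symmetric; Irreflexive)
open import Relation.Binary.PropositionalEquality using (_≡_; refl; sym; trans; cong)
open import Relation.Nullary using (Dec; ¬_; ¬?; does; _×-dec_; _⊎-dec_; _→-dec_)

-- Finite simple graphs, on the vertex set Fin order.
record Graph : Set₁ where
  infix 4 _~_ _~?_
  field
    order  : ℕ
    _~_    : Rel (Fin order) 0ℓ
    _~?_   : Decidable _~_
    ~-sym  : Symmetric _~_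
    ~-irr  : Irreflexive _≡_ _~_

  Vertex : Set
  Vertex = Fin order

  N : Vertex → Subset order
  N v = tabulate (λ w → does (v ~? w))

  degree : Vertex → ℕ
  degree v = ∣ N v ∣

  IsIndependent : Subset order → Set
  IsIndependent S = ∀ u v → u ∈ S → v ∈ S → ¬ (u ~ v)

  IsOddIndependent : Subset order → Set
  IsOddIndependent S =
    IsIndependent S ×
    (∀ v → v ∉ S → (∣ N v ∩ S ∣ ≡ 0) ⊎ (2 ∤ ∣ N v ∩ S ∣))

  isOddIndependent? : ∀ S → Dec (IsOddIndependent S)
  isOddIndependent? S =
    all? (λ u → all? (λ v → (u ∈? S) →-dec ((v ∈? S) →-dec ¬? (u ~? v))))
    ×-dec
    all? (λ v → ¬? (v ∈? S) →-dec
                ((∣ N v ∩ S ∣ ℕ.≟ 0) ⊎-dec ¬? (2 ∣? ∣ N v ∩ S ∣)))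

  IsBipartite : Set
  IsBipartite = ∃[ A ] (IsIndependent A × IsIndependent (∁ A))

  IsAutomorphism : Permutation′ order → Set
  IsAutomorphism η = ∀ u v → (u ~ v) ⇔ ((η ⟨$⟩ʳ u) ~ (η ⟨$⟩ʳ v))

-- O = { ηᵏ(v) : k ∈ ℕ } for some v; the set being finite, the negative
-- powers of η contribute no further points.
IsOrbit : ∀ {n} → Permutation′ n → Subset n → Set
IsOrbit {n} η O = ∃[ v ] (∀ w → (w ∈ O) ⇔ (∃[ k ] ((η ⟨$⟩ʳ_) ^ k) v ≡ w))
  where open Endo (Fin n) using (_^_)

subsets : ∀ n → List (Subset n)
subsets zero    = [] ∷ []
subsets (suc n) = map (inside ∷_) (subsets n) ++ map (outside ∷_) (subsets n)

-- The default value 0 does not affect the maximum: the empty set is an odd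
-- independent set (see αod-attained).
αod : Graph → ℕ
αod F = max 0 (map ∣_∣ (filter isOddIndependent? (subsets order)))
  where open Graph F

-- A vertex x of μ[ G , H ] is the copy of the vertex  base x  of G lying in
-- the copy of G that replaces the vertex  copy x  of H.
μ[_,_] : Graph → Graph → Graph
μ[ G , H ] = record
  { order = H.order * G.order
  ; _~_   = λ x y → (copy x ≡ copy y × base x G.~ base y)
                  ⊎ (base x ≡ base y × copy x H.~ copy y)
  ; _~?_  = λ x y → ((copy x ≟ copy y) ×-dec (base x G.~? base y))
             ⊎-dec ((base x ≟ base y) ×-dec (copy x H.~? copy y))
  ; ~-sym = Sum.map (Product.map sym G.~-sym) (Product.map sym H.~-sym)
  ; ~-irr = λ { refl (inj₁ (_ , e)) → G.~-irr refl e
              ; refl (inj₂ (_ , e)) → H.~-irr refl e }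
  }
  where
  module G = Graph G
  module H = Graph H

  copy : Fin (H.order * G.order) → H.Vertex
  copy = quotient G.order

  base : Fin (H.order * G.order) → G.Vertex
  base = remainder {H.order} G.order

∈-subsets : ∀ {n} (S : Subset n) → S List.∈ subsets n
∈-subsets []            = here refl
∈-subsets (inside  ∷ S) = ∈-++⁺ˡ (∈-map⁺ (inside ∷_) (∈-subsets S))
∈-subsets (outside ∷ S) =
  ∈-++⁺ʳ (map (inside ∷_) (subsets _)) (∈-map⁺ (outside ∷_) (∈-subsets S))

module _ (F : Graph) where
  open Graph F

  αod-upper : ∀ S → IsOddIndependent S → ∣ S ∣ ≤ αod F
  αod-upper S odd = All.lookup
    (xs≤max 0 (map ∣_∣ (filter isOddIndependent? (subsets order))))
    (∈-map⁺ ∣_∣ (∈-filter⁺ isOddIndependent? (∈-subsets S) odd))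

  ⊥-oddIndependent : IsOddIndependent ⊥
  ⊥-oddIndependent =
    (λ u v u∈⊥ _ _ → ∉⊥ u∈⊥) ,
    (λ v _ → inj₁ (trans (cong ∣_∣ (∩-zeroʳ (N v))) (∣⊥∣≡0 order)))

  αod-attained : ∃[ S ] (IsOddIndependent S × ∣ S ∣ ≡ αod F)
  αod-attained
    with argmax-sel id 0 (map ∣_∣ (filter isOddIndependent? (subsets order)))
  ... | inj₁ α≡0 = ⊥ , ⊥-oddIndependent , trans (∣⊥∣≡0 order) (sym α≡0)
  ... | inj₂ α∈  with ∈-map⁻ ∣_∣ α∈
  ...   | S , S∈ , α≡∣S∣ =
    S , proj₂ (∈-filter⁻ isOddIndependent? {xs = subsets order} S∈) , sym α≡∣S∣

{-# OPTIONS --safe #-}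
-- Let S be a maximum odd independent set of G and T = η⁻¹(S), which is again
-- odd independent of the same size.  Put S into the copies of G over one side
-- of the bipartition of H and T into the copies over the other side.  Every
-- vertex of T has a neighbour in S (its image under η), and vice versa, so S
-- and T are disjoint and the union of all copies is independent.  A vertex
-- (w , v) outside the union has, besides its neighbours in its own copy of G,
-- either no neighbours or exactly deg w many, and the latter happens only if v
-- lies in the set used on the opposite side; then v has a neighbour in its own
-- copy, hence an odd number of them, and adding the even number deg w keeps it
-- odd.
module Submission where

open import Defs
open import Data.Bool using (Bool; true; false; not; if_then_else_)
open import Data.Fin using (Fin; zero; suc; _↑ˡ_; _↑ʳ_; combine; quotient; remainder; _≟_)
open import Data.Fin.Permutation using (Permutation; Permutation′; _⟨$⟩ʳ_; _⟨$⟩ˡ_; inverseʳ)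
open import Data.Fin.Properties using (remQuot-combine)
open import Data.Fin.Subset using (Subset; inside; outside; _∈_; _⊆_; _∩_; ∁; ∣_∣; Nonempty; Empty)
open import Data.Fin.Subset.Properties
  using (_∈?_; nonempty?; Empty-unique; ∣⊥∣≡0; x∈p⇒∣p-x∣<∣p∣; x∉p⇒x∈∁p; ⊆-antisym;
         p∩q⊆p; x∈p∩q⁺; x∈p∩q⁻; ∩⇔×)
open import Data.Nat using (ℕ; zero; suc; _+_; _*_; _≥_)
open import Data.Nat.Divisibility using (_∣_; _∤_; _∣0; ∣m+n∣m⇒∣n)
open import Data.Nat.Properties
  using (+-assoc; +-comm; +-identityʳ; *-assoc; *-distribʳ-+; +-*-semiring; m<n⇒n≢0; module ≤-Reasoning)
open import Data.Product using (_×_; _,_; Σ-syntax; proj₁; proj₂)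
open import Data.Product.Function.NonDependent.Propositional using (_×-⇔_)
open import Data.Sum using (_⊎_; inj₁; inj₂)
open import Data.Vec using ([]; _∷_; lookup; tabulate)
open import Data.Vec.Properties using ([]=⇒lookup; lookup⇒[]=; lookup∘tabulate)
open import Function using (_∘_; _⇔_; mk⇔; Equivalence)
open import Function.Construct.Composition using (_⇔-∘_)
open import Function.Construct.Identity using (⇔-id)
open import Level using (Level)
open import Relation.Binary.PropositionalEquality
  using (_≡_; refl; sym; trans; cong; cong₂; subst; module ≡-Reasoning)
open import Relation.Nullary
  using (Dec; yes; no; ¬_; does; proof; invert; Reflects; contradiction; _×-dec_; _⊎-dec_)
open import Relation.Nullary.Decidable using (dec-true; does-⇔)
open import Relation.Unary using (Pred; Decidable)

open import Algebra.Properties.Semiring.Sum +-*-semiring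
  using (sum; sum-cong-≗; sum-syntax; sum-replicate-zero; sum-permute; ∑-distrib-+; ∑-comm)
open Equivalence using (to; from)

private variable
  a b : Level
  A B : Set a
  m n : ℕ

𝟙 : Dec A → ℕ
𝟙 a? = if does a? then 1 else 0

𝟙-⇔ : A ⇔ B → (a? : Dec A) (b? : Dec B) → 𝟙 a? ≡ 𝟙 b?
𝟙-⇔ A⇔B a? b? = cong (if_then 1 else 0) (does-⇔ A⇔B a? b?)

𝟙-× : (a? : Dec A) (b? : Dec B) → 𝟙 (a? ×-dec b?) ≡ 𝟙 a? * 𝟙 b?
𝟙-× (yes _) b? = sym (+-identityʳ (𝟙 b?))
𝟙-× (no  _) b? = refl

𝟙-⊎ : (a? : Dec A) (b? : Dec B) → ¬ (A × B) → 𝟙 (a? ⊎-dec b?) ≡ 𝟙 a? + 𝟙 b?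
𝟙-⊎ (yes a) (yes b) ¬ab = contradiction (a , b) ¬ab
𝟙-⊎ (yes _) (no  _) _   = refl
𝟙-⊎ (no  _) b?      _   = refl

sum-const : ∀ n c → ∑[ i < n ] c ≡ n * c
sum-const zero    c = refl
sum-const (suc n) c = cong (c +_) (sum-const n c)

sum-𝟙≟ : (k : Fin n) (f : Fin n → ℕ) → ∑[ i < n ] (𝟙 (k ≟ i) * f i) ≡ f k
sum-𝟙≟ {suc n} zero    f = begin
  (f zero + 0) + ∑[ i < n ] 0  ≡⟨ cong₂ _+_ (+-identityʳ (f zero)) (sum-replicate-zero n) ⟩
  f zero + 0                   ≡⟨ +-identityʳ (f zero) ⟩
  f zero                       ∎
  where open ≡-Reasoning
sum-𝟙≟ {suc n} (suc k) f = sum-𝟙≟ k (f ∘ suc)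

sum-↑ : ∀ m (f : Fin (m + n) → ℕ) → sum f ≡ sum (f ∘ (_↑ˡ n)) + sum (f ∘ (m ↑ʳ_))
sum-↑ zero    f = refl
sum-↑ (suc m) f = trans (cong (f zero +_) (sum-↑ m (f ∘ suc))) (sym (+-assoc (f zero) _ _))

sum-combine : ∀ m n (f : Fin (m * n) → ℕ) → sum f ≡ ∑[ i < m ] ∑[ j < n ] f (combine i j)
sum-combine zero    n f = refl
sum-combine (suc m) n f = trans (sum-↑ n f)
  (cong (sum (f ∘ (_↑ˡ (m * n))) +_) (sum-combine m n (f ∘ (n ↑ʳ_))))

sum-quotient-remainder : ∀ m n (f : Fin m → Fin n → ℕ) →
  ∑[ x < m * n ] f (quotient n x) (remainder {m} n x) ≡ ∑[ i < m ] ∑[ j < n ] f i j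
sum-quotient-remainder m n f = trans (sum-combine m n _) (sum-cong-≗ λ i → sum-cong-≗ λ j →
  cong (λ q → f (proj₁ q) (proj₂ q)) (remQuot-combine {m} {n} i j))

sum-𝟙≟quotient : (k : Fin m) (f : Fin m → Fin n → ℕ) →
  ∑[ x < m * n ] (𝟙 (k ≟ quotient n x) * f (quotient n x) (remainder {m} n x)) ≡ ∑[ j < n ] f k j
sum-𝟙≟quotient {m} {n} k f = begin
  ∑[ x < m * n ] (𝟙 (k ≟ quotient n x) * f (quotient n x) (remainder {m} n x))
    ≡⟨ sum-quotient-remainder m n (λ i j → 𝟙 (k ≟ i) * f i j) ⟩
  ∑[ i < m ] ∑[ j < n ] (𝟙 (k ≟ i) * f i j)
    ≡⟨ ∑-comm (λ i j → 𝟙 (k ≟ i) * f i j) ⟩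
  ∑[ j < n ] ∑[ i < m ] (𝟙 (k ≟ i) * f i j)
    ≡⟨ sum-cong-≗ (λ j → sum-𝟙≟ k (λ i → f i j)) ⟩
  ∑[ j < n ] f k j ∎
  where open ≡-Reasoning

sum-𝟙≟remainder : (k : Fin n) (f : Fin m → Fin n → ℕ) →
  ∑[ x < m * n ] (𝟙 (k ≟ remainder {m} n x) * f (quotient n x) (remainder {m} n x)) ≡ ∑[ i < m ] f i k
sum-𝟙≟remainder {n} {m} k f = begin
  ∑[ x < m * n ] (𝟙 (k ≟ remainder {m} n x) * f (quotient n x) (remainder {m} n x))
    ≡⟨ sum-quotient-remainder m n (λ i j → 𝟙 (k ≟ j) * f i j) ⟩
  ∑[ i < m ] ∑[ j < n ] (𝟙 (k ≟ j) * f i j)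
    ≡⟨ sum-cong-≗ (λ i → sum-𝟙≟ k (f i)) ⟩
  ∑[ i < m ] f i k ∎
  where open ≡-Reasoning

comprehension : {P : Pred (Fin n) a} → Decidable P → Subset n
comprehension P? = tabulate (does ∘ P?)

∈-comprehension : {P : Pred (Fin n) a} (P? : Decidable P) → ∀ i → i ∈ comprehension P? ⇔ P i
∈-comprehension {P = P} P? i = mk⇔
  (λ i∈ → invert (subst (Reflects (P i)) (trans (sym lookup≡does) ([]=⇒lookup i∈)) (proof (P? i))))
  (λ Pi → lookup⇒[]= i (comprehension P?) (trans lookup≡does (dec-true (P? i) Pi)))
  where
  lookup≡does : lookup (comprehension P?) i ≡ does (P? i)
  lookup≡does = lookup∘tabulate (does ∘ P?) i

∣p∣≡∑𝟙∈ : (p : Subset n) → ∣ p ∣ ≡ ∑[ i < n ] 𝟙 (i ∈? p)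
∣p∣≡∑𝟙∈ []            = refl
∣p∣≡∑𝟙∈ (inside  ∷ p) = cong suc (∣p∣≡∑𝟙∈ p)
∣p∣≡∑𝟙∈ (outside ∷ p) = ∣p∣≡∑𝟙∈ p

∣p∣≡∑𝟙 : {P : Pred (Fin n) a} (P? : Decidable P) {p : Subset n} →
         (∀ i → i ∈ p ⇔ P i) → ∣ p ∣ ≡ ∑[ i < n ] 𝟙 (P? i)
∣p∣≡∑𝟙 P? {p} p⇔P = trans (∣p∣≡∑𝟙∈ p) (sum-cong-≗ λ i → 𝟙-⇔ (p⇔P i) (i ∈? p) (P? i))

∣p∩q∣≡∑𝟙*𝟙 : {P : Pred (Fin n) a} {Q : Pred (Fin n) b}
             (P? : Decidable P) (Q? : Decidable Q) {p q : Subset n} →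
             (∀ i → i ∈ p ⇔ P i) → (∀ i → i ∈ q ⇔ Q i) →
             ∣ p ∩ q ∣ ≡ ∑[ i < n ] (𝟙 (P? i) * 𝟙 (Q? i))
∣p∩q∣≡∑𝟙*𝟙 P? Q? p⇔P q⇔Q = trans
  (∣p∣≡∑𝟙 (λ i → P? i ×-dec Q? i) (λ i → (p⇔P i ×-⇔ q⇔Q i) ⇔-∘ ∩⇔×))
  (sum-cong-≗ λ i → 𝟙-× (P? i) (Q? i))

Empty⇒∣p∣≡0 : {p : Subset n} → Empty p → ∣ p ∣ ≡ 0
Empty⇒∣p∣≡0 {n} empty = trans (cong ∣_∣ (Empty-unique empty)) (∣⊥∣≡0 n)

∣p∣≡0⇒Empty : {p : Subset n} → ∣ p ∣ ≡ 0 → Empty p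
∣p∣≡0⇒Empty ∣p∣≡0 (x , x∈p) = m<n⇒n≢0 (x∈p⇒∣p-x∣<∣p∣ x∈p) ∣p∣≡0

p⊆q⇒p∩q≡p : {p q : Subset n} → p ⊆ q → p ∩ q ≡ p
p⊆q⇒p∩q≡p {p = p} {q} p⊆q = ⊆-antisym (p∩q⊆p p q) (λ x∈p → x∈p∩q⁺ (x∈p , p⊆q x∈p))

preimage : (Fin m → Fin n) → Subset n → Subset m
preimage f p = comprehension (λ i → f i ∈? p)

∈-preimage : (f : Fin m → Fin n) (p : Subset n) → ∀ i → i ∈ preimage f p ⇔ f i ∈ p
∈-preimage f p = ∈-comprehension (λ i → f i ∈? p)

∣preimage∣ : (π : Permutation m n) (p : Subset n) → ∣ preimage (π ⟨$⟩ʳ_) p ∣ ≡ ∣ p ∣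
∣preimage∣ {m} {n} π p = begin
  ∣ preimage (π ⟨$⟩ʳ_) p ∣        ≡⟨ ∣p∣≡∑𝟙 (λ i → (π ⟨$⟩ʳ i) ∈? p) (∈-preimage (π ⟨$⟩ʳ_) p) ⟩
  ∑[ i < m ] 𝟙 ((π ⟨$⟩ʳ i) ∈? p)  ≡⟨ sum-permute (λ i → 𝟙 (i ∈? p)) π ⟨
  ∑[ i < n ] 𝟙 (i ∈? p)           ≡⟨ ∣p∣≡∑𝟙∈ p ⟨
  ∣ p ∣                           ∎
  where open ≡-Reasoning

infix 10 _ᵀ

_ᵀ : (Fin m → Subset n) → Fin n → Subset m
(F ᵀ) j = comprehension (λ i → j ∈? F i)

∈-ᵀ : (F : Fin m → Subset n) → ∀ {j} i → i ∈ (F ᵀ) j ⇔ j ∈ F i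
∈-ᵀ F {j} = ∈-comprehension (λ i → j ∈? F i)

fromLayers : (Fin m → Subset n) → Subset (m * n)
fromLayers {m} {n} F = comprehension (λ x → remainder {m} n x ∈? F (quotient n x))

∈-fromLayers : (F : Fin m → Subset n) → ∀ x → x ∈ fromLayers F ⇔ remainder {m} n x ∈ F (quotient n x)
∈-fromLayers {m} {n} F = ∈-comprehension (λ x → remainder {m} n x ∈? F (quotient n x))

∣fromLayers∣ : (F : Fin m → Subset n) → ∣ fromLayers F ∣ ≡ ∑[ i < m ] ∣ F i ∣
∣fromLayers∣ {m} {n} F = begin
  ∣ fromLayers F ∣
    ≡⟨ ∣p∣≡∑𝟙 (λ x → remainder {m} n x ∈? F (quotient n x)) (∈-fromLayers F) ⟩
  ∑[ x < m * n ] 𝟙 (remainder {m} n x ∈? F (quotient n x))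
    ≡⟨ sum-quotient-remainder m n (λ i j → 𝟙 (j ∈? F i)) ⟩
  ∑[ i < m ] ∑[ j < n ] 𝟙 (j ∈? F i)
    ≡⟨ sum-cong-≗ (∣p∣≡∑𝟙∈ ∘ F) ⟨
  ∑[ i < m ] ∣ F i ∣ ∎
  where open ≡-Reasoning

ZeroOrOdd : ℕ → Set
ZeroOrOdd k = (k ≡ 0) ⊎ (2 ∤ k)

zeroOrOdd-+ : ZeroOrOdd m → 2 ∣ n → (m ≡ 0 → n ≡ 0) → ZeroOrOdd (m + n)
zeroOrOdd-+         (inj₁ m≡0) _   m≡0⇒n≡0 = inj₁ (cong₂ _+_ m≡0 (m≡0⇒n≡0 m≡0))
zeroOrOdd-+ {m} {n} (inj₂ 2∤m) 2∣n _       =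
  inj₂ λ 2∣m+n → 2∤m (∣m+n∣m⇒∣n (subst (2 ∣_) (+-comm m n) 2∣m+n) 2∣n)

module _ (G : Graph) where
  open Graph G

  ∈-N : ∀ v u → u ∈ N v ⇔ v ~ u
  ∈-N v = ∈-comprehension (v ~?_)

  TotallyDominates : Subset order → Subset order → Set
  TotallyDominates S T = ∀ {v} → v ∈ T → Nonempty (N v ∩ S)

  ConstantOnNeighbourhoods : {A : Set a} → (Vertex → A) → Set a
  ConstantOnNeighbourhoods f = ∀ {v i j} → v ~ i → v ~ j → f i ≡ f j

  IsProper2Colouring : (Vertex → Bool) → Set
  IsProper2Colouring c = ∀ {u v} → u ~ v → c v ≡ not (c u)

  totallyDominates⇒disjoint : ∀ {S T} → IsIndependent S → TotallyDominates S T → Empty (S ∩ T)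
  totallyDominates⇒disjoint {S} {T} independent dominates (v , v∈S∩T)
    with v∈S , v∈T ← x∈p∩q⁻ S T v∈S∩T
    with u , u∈N∩S ← dominates v∈T
    with u∈N , u∈S ← x∈p∩q⁻ (N v) S u∈N∩S
    = independent v u v∈S u∈S (to (∈-N v u) u∈N)

  ∣N∩ᵀ∣≡0⊎degree : (F : Vertex → Subset n) → ConstantOnNeighbourhoods F →
                   ∀ w v → (∣ N w ∩ (F ᵀ) v ∣ ≡ 0) ⊎ (∣ N w ∩ (F ᵀ) v ∣ ≡ degree w)
  ∣N∩ᵀ∣≡0⊎degree F constant w v with nonempty? (N w ∩ (F ᵀ) v)
  ... | no  empty    = inj₁ (Empty⇒∣p∣≡0 empty)
  ... | yes (i , i∈) = inj₂ (cong ∣_∣ (p⊆q⇒p∩q≡p N⊆Fᵀ))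
    where
    w~i : w ~ i
    w~i = to (∈-N w i) (proj₁ (x∈p∩q⁻ (N w) _ i∈))

    v∈Fi : v ∈ F i
    v∈Fi = to (∈-ᵀ F i) (proj₂ (x∈p∩q⁻ (N w) _ i∈))

    N⊆Fᵀ : N w ⊆ (F ᵀ) v
    N⊆Fᵀ {j} j∈N = from (∈-ᵀ F j) (subst (v ∈_) (constant w~i (to (∈-N w j) j∈N)) v∈Fi)

  bipartition⇒proper2Colouring : ∀ {A} → IsIndependent A → IsIndependent (∁ A) →
                                 IsProper2Colouring (lookup A)
  bipartition⇒proper2Colouring {A} ind ind∁ {u} {v} u~v with lookup A u in Au | lookup A v in Av
  ... | inside  | inside  = contradiction u~v (ind u v (lookup⇒[]= u A Au) (lookup⇒[]= v A Av))
  ... | inside  | outside = refl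
  ... | outside | inside  = refl
  ... | outside | outside = contradiction u~v (ind∁ u v (outside⇒∈∁ Au) (outside⇒∈∁ Av))
    where
    outside⇒∈∁ : ∀ {w} → lookup A w ≡ outside → w ∈ ∁ A
    outside⇒∈∁ Aw = x∉p⇒x∈∁p λ w∈A → contradiction (trans (sym Aw) ([]=⇒lookup w∈A)) λ ()

  proper2Colouring⇒constantOnNeighbourhoods : ∀ {c} → IsProper2Colouring c → ConstantOnNeighbourhoods c
  proper2Colouring⇒constantOnNeighbourhoods proper v~i v~j = trans (proper v~i) (sym (proper v~j))

  totallyDominates-preimage : ∀ {f} → (∀ v → f v ∈ N v) → ∀ S → TotallyDominates S (preimage f S)
  totallyDominates-preimage {f} f∈N S {v} v∈ = f v , x∈p∩q⁺ (f∈N v , to (∈-preimage f S v) v∈)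

  preimage-totallyDominates : (π : Permutation′ order) → (∀ v → (π ⟨$⟩ʳ v) ∈ N v) →
                              ∀ S → TotallyDominates (preimage (π ⟨$⟩ʳ_) S) S
  preimage-totallyDominates π π∈N S {v} v∈S = u , x∈p∩q⁺ (u∈N , u∈preimage)
    where
    u : Vertex
    u = π ⟨$⟩ˡ v

    u∈N : u ∈ N v
    u∈N = from (∈-N v u) (~-sym (to (∈-N u v) (subst (_∈ N u) (inverseʳ π) (π∈N u))))

    u∈preimage : u ∈ preimage (π ⟨$⟩ʳ_) S
    u∈preimage = from (∈-preimage (π ⟨$⟩ʳ_) S u) (subst (_∈ S) (sym (inverseʳ π)) v∈S)

module _ (G : Graph) (η : Permutation′ (Graph.order G)) (aut : Graph.IsAutomorphism G η) where
  open Graph G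

  ∣N∩preimage∣ : ∀ S v → ∣ N v ∩ preimage (η ⟨$⟩ʳ_) S ∣ ≡ ∣ N (η ⟨$⟩ʳ v) ∩ S ∣
  ∣N∩preimage∣ S v = begin
    ∣ N v ∩ preimage (η ⟨$⟩ʳ_) S ∣
      ≡⟨ ∣p∩q∣≡∑𝟙*𝟙 (v ~?_) (λ u → (η ⟨$⟩ʳ u) ∈? S) (∈-N G v) (∈-preimage (η ⟨$⟩ʳ_) S) ⟩
    ∑[ u < order ] (𝟙 (v ~? u) * 𝟙 ((η ⟨$⟩ʳ u) ∈? S))
      ≡⟨ sum-cong-≗ (λ u → cong (_* _) (𝟙-⇔ (aut v u) (v ~? u) ((η ⟨$⟩ʳ v) ~? (η ⟨$⟩ʳ u)))) ⟩
    ∑[ u < order ] (𝟙 ((η ⟨$⟩ʳ v) ~? (η ⟨$⟩ʳ u)) * 𝟙 ((η ⟨$⟩ʳ u) ∈? S))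
      ≡⟨ sum-permute (λ u → 𝟙 ((η ⟨$⟩ʳ v) ~? u) * 𝟙 (u ∈? S)) η ⟨
    ∑[ u < order ] (𝟙 ((η ⟨$⟩ʳ v) ~? u) * 𝟙 (u ∈? S))
      ≡⟨ ∣p∩q∣≡∑𝟙*𝟙 ((η ⟨$⟩ʳ v) ~?_) (_∈? S) (∈-N G (η ⟨$⟩ʳ v)) (λ u → ⇔-id (u ∈ S)) ⟨
    ∣ N (η ⟨$⟩ʳ v) ∩ S ∣ ∎
    where open ≡-Reasoning

  preimage-isOddIndependent : ∀ {S} → IsOddIndependent S → IsOddIndependent (preimage (η ⟨$⟩ʳ_) S)
  preimage-isOddIndependent {S} (independent , zeroOrOdd) =
    (λ u v u∈ v∈ u~v → independent _ _ (to (∈η⁻¹ u) u∈) (to (∈η⁻¹ v) v∈) (to (aut u v) u~v)) ,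
    (λ v v∉ → subst ZeroOrOdd (sym (∣N∩preimage∣ S v)) (zeroOrOdd (η ⟨$⟩ʳ v) (v∉ ∘ from (∈η⁻¹ v))))
    where
    ∈η⁻¹ : ∀ v → v ∈ preimage (η ⟨$⟩ʳ_) S ⇔ (η ⟨$⟩ʳ v) ∈ S
    ∈η⁻¹ = ∈-preimage (η ⟨$⟩ʳ_) S

module _ (G H : Graph) where
  private
    module G = Graph G
    module H = Graph H
    module M = Graph μ[ G , H ]

    copy : M.Vertex → H.Vertex
    copy = quotient G.order

    base : M.Vertex → G.Vertex
    base = remainder {H.order} G.order

  -- The Kronecker sum of the adjacency matrices of H and G.
  adjacency-μ : ∀ x y →
    𝟙 (x M.~? y) ≡ 𝟙 (copy x ≟ copy y) * 𝟙 (base x G.~? base y)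
                 + 𝟙 (base x ≟ base y) * 𝟙 (copy x H.~? copy y)
  adjacency-μ x y = trans
    (𝟙-⊎ ((copy x ≟ copy y) ×-dec (base x G.~? base y))
         ((base x ≟ base y) ×-dec (copy x H.~? copy y))
         λ ((same , _) , (_ , adjacent)) → H.~-irr same adjacent)
    (cong₂ _+_ (𝟙-× (copy x ≟ copy y) (base x G.~? base y))
               (𝟙-× (base x ≟ base y) (copy x H.~? copy y)))

  module _ (F : H.Vertex → Subset G.order) where

    ∣N∩fromLayers∣ : ∀ x → ∣ M.N x ∩ fromLayers F ∣ ≡
                     ∣ G.N (base x) ∩ F (copy x) ∣ + ∣ H.N (copy x) ∩ (F ᵀ) (base x) ∣
    ∣N∩fromLayers∣ x = begin
      ∣ M.N x ∩ fromLayers F ∣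
        ≡⟨ ∣p∩q∣≡∑𝟙*𝟙 (x M.~?_) (λ y → base y ∈? F (copy y)) (∈-N μ[ G , H ] x) (∈-fromLayers F) ⟩
      ∑[ y < M.order ] (𝟙 (x M.~? y) * 𝟙 (base y ∈? F (copy y)))
        ≡⟨ sum-cong-≗ split ⟩
      ∑[ y < M.order ] (𝟙 (w ≟ copy y) * within (copy y) (base y) + 𝟙 (v ≟ base y) * across (copy y) (base y))
        ≡⟨ ∑-distrib-+ (λ y → 𝟙 (w ≟ copy y) * within (copy y) (base y)) _ ⟩
      ∑[ y < M.order ] (𝟙 (w ≟ copy y) * within (copy y) (base y))
        + ∑[ y < M.order ] (𝟙 (v ≟ base y) * across (copy y) (base y))
        ≡⟨ cong₂ _+_ (sum-𝟙≟quotient w within) (sum-𝟙≟remainder v across) ⟩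
      ∑[ j < G.order ] within w j + ∑[ i < H.order ] across i v
        ≡⟨ cong₂ _+_ (∣p∩q∣≡∑𝟙*𝟙 (v G.~?_) (_∈? F w) (∈-N G v) (λ j → ⇔-id (j ∈ F w)))
                     (∣p∩q∣≡∑𝟙*𝟙 (w H.~?_) (λ i → v ∈? F i) (∈-N H w) (∈-ᵀ F)) ⟨
      ∣ G.N v ∩ F w ∣ + ∣ H.N w ∩ (F ᵀ) v ∣ ∎
      where
      open ≡-Reasoning

      v : G.Vertex
      v = base x

      w : H.Vertex
      w = copy x

      within across : H.Vertex → G.Vertex → ℕ
      within i j = 𝟙 (v G.~? j) * 𝟙 (j ∈? F i)
      across i j = 𝟙 (w H.~? i) * 𝟙 (j ∈? F i)

      split : ∀ y → 𝟙 (x M.~? y) * 𝟙 (base y ∈? F (copy y))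
                  ≡ 𝟙 (w ≟ copy y) * within (copy y) (base y) + 𝟙 (v ≟ base y) * across (copy y) (base y)
      split y
        rewrite adjacency-μ x y
              | *-distribʳ-+ (𝟙 (base y ∈? F (copy y))) (𝟙 (w ≟ copy y) * 𝟙 (v G.~? base y))
                                                        (𝟙 (v ≟ base y) * 𝟙 (w H.~? copy y))
        = cong₂ _+_ (*-assoc (𝟙 (w ≟ copy y)) _ _) (*-assoc (𝟙 (v ≟ base y)) _ _)

    fromLayers-isIndependent : (∀ w → G.IsIndependent (F w)) →
                               (∀ {w w′} → w H.~ w′ → Empty (F w ∩ F w′)) →
                               M.IsIndependent (fromLayers F)
    fromLayers-isIndependent independent disjoint x y x∈ y∈ = nonadjacent
      where
      x∈F : base x ∈ F (copy x)
      x∈F = to (∈-fromLayers F x) x∈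

      y∈F : base y ∈ F (copy y)
      y∈F = to (∈-fromLayers F y) y∈

      nonadjacent : ¬ (x M.~ y)
      nonadjacent (inj₁ (same , adjacent)) =
        independent (copy y) (base x) (base y) (subst (λ w → base x ∈ F w) same x∈F) y∈F adjacent
      nonadjacent (inj₂ (same , adjacent)) =
        disjoint adjacent (base y , x∈p∩q⁺ (subst (_∈ F (copy x)) same x∈F , y∈F))

    fromLayers-isOddIndependent : (∀ w → G.IsOddIndependent (F w)) →
                                  (∀ {w w′} → w H.~ w′ → TotallyDominates G (F w) (F w′)) →
                                  (∀ w v → 2 ∣ ∣ H.N w ∩ (F ᵀ) v ∣) →
                                  M.IsOddIndependent (fromLayers F)
    fromLayers-isOddIndependent odd dominates even =
      fromLayers-isIndependent (proj₁ ∘ odd)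
        (λ {w} w~w′ → totallyDominates⇒disjoint G (proj₁ (odd w)) (dominates w~w′)) ,
      λ x x∉ → subst ZeroOrOdd (sym (∣N∩fromLayers∣ x))
        (zeroOrOdd-+ (proj₂ (odd (copy x)) (base x) (x∉ ∘ from (∈-fromLayers F x)))
                     (even (copy x) (base x))
                     (∣N∩F∣≡0⇒∣N∩Fᵀ∣≡0 (copy x) (base x)))
      where
      ∣N∩F∣≡0⇒∣N∩Fᵀ∣≡0 : ∀ w v → ∣ G.N v ∩ F w ∣ ≡ 0 → ∣ H.N w ∩ (F ᵀ) v ∣ ≡ 0
      ∣N∩F∣≡0⇒∣N∩Fᵀ∣≡0 w v ∣N∩F∣≡0 = Empty⇒∣p∣≡0 λ (i , i∈) →
        let i∈N , i∈Fᵀ = x∈p∩q⁻ (H.N w) ((F ᵀ) v) i∈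
        in ∣p∣≡0⇒Empty ∣N∩F∣≡0 (dominates (to (∈-N H w i) i∈N) (to (∈-ᵀ F i) i∈Fᵀ))

  fromLayers∘2colouring-isOddIndependent :
    ∀ {c} → IsProper2Colouring H c → (∀ w → 2 ∣ H.degree w) →
    {S : Bool → Subset G.order} → (∀ b → G.IsOddIndependent (S b)) →
    (∀ b → TotallyDominates G (S b) (S (not b))) →
    M.IsOddIndependent (fromLayers (S ∘ c))
  fromLayers∘2colouring-isOddIndependent {c} proper evenDegree {S} odd dominates =
    fromLayers-isOddIndependent (S ∘ c) (odd ∘ c)
      (λ {w} w~w′ → subst (TotallyDominates G (S (c w)) ∘ S) (sym (proper w~w′)) (dominates (c w)))
      even
    where
    constant : ConstantOnNeighbourhoods H (S ∘ c)
    constant v~i v~j = cong S (proper2Colouring⇒constantOnNeighbourhoods H proper v~i v~j)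

    even : ∀ w v → 2 ∣ ∣ H.N w ∩ ((S ∘ c) ᵀ) v ∣
    even w v with ∣N∩ᵀ∣≡0⊎degree H (S ∘ c) constant w v
    ... | inj₁ ∣N∩ᵀ∣≡0      = subst (2 ∣_) (sym ∣N∩ᵀ∣≡0) (2 ∣0)
    ... | inj₂ ∣N∩ᵀ∣≡degree = subst (2 ∣_) (sym ∣N∩ᵀ∣≡degree) (evenDegree w)

theorem3 : (G H : Graph) →
    (Σ[ η ∈ Permutation′ (Graph.order G) ] (Graph.IsAutomorphism G η × (∀ v → (η ⟨$⟩ʳ v) ∈ Graph.N G v) × (∀ O → IsOrbit η O → 2 ∣ ∣ O ∣))) →
    (Graph.IsBipartite H × (∀ w → 2 ∣ Graph.degree H w)) →
    αod μ[ G , H ] ≥ Graph.order H * αod G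
theorem3 G H (η , aut , η∈N , _) ((A , ind , ind∁) , evenDegree)
  with S , S-odd , ∣S∣≡α ← αod-attained G = begin
  H.order * αod G                      ≡⟨ sum-const H.order (αod G) ⟨
  ∑[ w < H.order ] αod G               ≡⟨ sum-cong-≗ (∣layer∣ ∘ side) ⟨
  ∑[ w < H.order ] ∣ layer (side w) ∣  ≡⟨ ∣fromLayers∣ (layer ∘ side) ⟨
  ∣ fromLayers (layer ∘ side) ∣        ≤⟨ αod-upper μ[ G , H ] (fromLayers (layer ∘ side)) union-odd ⟩
  αod μ[ G , H ]                       ∎
  where
  open ≤-Reasoning
  module G = Graph G
  module H = Graph H

  side : H.Vertex → Bool
  side = lookup A

  layer : Bool → Subset G.order
  layer b = if b then S else preimage (η ⟨$⟩ʳ_) S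

  ∣layer∣ : ∀ b → ∣ layer b ∣ ≡ αod G
  ∣layer∣ true  = ∣S∣≡α
  ∣layer∣ false = trans (∣preimage∣ η S) ∣S∣≡α

  layer-odd : ∀ b → G.IsOddIndependent (layer b)
  layer-odd true  = S-odd
  layer-odd false = preimage-isOddIndependent G η aut S-odd

  layer-dominates : ∀ b → TotallyDominates G (layer b) (layer (not b))
  layer-dominates true  = totallyDominates-preimage G η∈N S
  layer-dominates false = preimage-totallyDominates G η η∈N S

  union-odd : Graph.IsOddIndependent μ[ G , H ] (fromLayers (layer ∘ side))
  union-odd = fromLayers∘2colouring-isOddIndependent G H
    (bipartition⇒proper2Colouring H ind ind∁) evenDegree layer-odd layer-dominates
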